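{- Let $r$ and $s$ be integers with $r\geq 3$ and $2\leq s\leq r$, and let $\gamma$ be a real number with $0\leq\gamma\leq\frac{r-2}{2(r-1)}$. If $G$ is an $n$-vertex $K_{r}$-free graph with at least $\gamma n^{2}$ edges, then the $K_{s}$-independence number of $G$ is at most $\left(\frac{s-1}{r-1}+d_{r,\gamma}(s)\right)n$.
   Context: Graphs are finite and simple. The $K_s$-independence number of a graph $G$ is the maximum order (number of vertices) of an induced $K_s$-free subgraph of $G$. For an integer $r\ge 3$, a real number $0\le\gamma\le\frac{r-2}{2(r-1)}$ and an integer $s$ with $2\le s\le r$, define \[d_{r,\gamma}(s):=\sqrt{\frac{2(s-1)(r-s)}{r-1}\left(\frac{r-2}{2(r-1)}-\gamma\right)}.\] -}

module Defs where

open import Data.Empty using (⊥-elim)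
open import Data.Fin using (Fin; finToFun; funToFin)
import Data.Fin as Fin
import Data.Fin.Properties as Fin
open import Data.Fin.Subset using (Subset; _∈_; ∣_∣) renaming (⊥ to ∅)
open import Data.Fin.Subset.Properties using (_∈?_; anySubset?; ∉⊥; ∣⊥∣≡0; ∣p∣≤n)
open import Data.Integer using (+_)
open import Data.List using (allFin; cartesianProduct; filter; length)
open import Data.Nat using (ℕ; zero; suc; NonZero; z≤n; s≤s)
import Data.Nat as ℕ
import Data.Nat.Properties as ℕ
open import Data.Product using (_×_; _,_; ∃; ∃-syntax; Σ-syntax; proj₁; proj₂)
open import Data.Rational using (ℚ; 0ℚ; 1ℚ; _+_; _*_; _-_; -_; 1/_; _/_; _<_; Positive; positive; nonNegative)
open import Data.Rational.Properties
open import Data.Rational.Solver using (module +-*-Solver)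
open import Data.Sum using (_⊎_; inj₁; inj₂)
open import Function using (_∘_)
open import Function.Definitions using (Injective)
open import Level using (0ℓ)
open import Relation.Binary.Core using (Rel)
open import Relation.Binary.Definitions using (Decidable; Irreflexive; Symmetric; tri<; tri≈; tri>)
open import Relation.Binary.PropositionalEquality using (_≡_; _≢_; refl; sym; trans; cong; subst; subst₂)
open import Relation.Nullary using (Dec; yes; no; ¬_; contradiction)
open import Relation.Nullary.Decidable using (¬?; map′; _×-dec_; _→-dec_)

------------------------------------------------------------------------
-- Real numbers, as two-sided located Dedekind cuts of ℚ: L holds of the
-- rationals strictly below the number and U of those strictly above it.

record ℝ : Set₁ where
  field
    L U          : ℚ → Set
    L-inhabited  : ∃ L
    U-inhabited  : ∃ U
    L-down       : ∀ {p q} → p < q → L q → L p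
    U-up         : ∀ {p q} → p < q → U p → U q
    L-open       : ∀ {p} → L p → ∃[ q ] p < q × L q
    U-open       : ∀ {q} → U q → ∃[ p ] p < q × U p
    disjoint     : ∀ {q} → L q → ¬ U q
    located      : ∀ {p q} → p < q → L p ⊎ U q

infix  4 _≤ℝ_
infix  8 -ℝ_
infixl 6 _ℚ+_
infixl 7 _ℚ*_
infix  8 √_

_≤ℝ_ : ℝ → ℝ → Set
x ≤ℝ y = ∀ {q} → ℝ.L x q → ℝ.L y q

private
  open +-*-Solver using (solve; _:+_; _:-_; :-_; _:=_)

  neg-involutive : ∀ p → - (- p) ≡ p
  neg-involutive = solve 1 (λ p → :- (:- p) := p) refl

  p-1<p : ∀ p → p - 1ℚ < p
  p-1<p p = subst (p - 1ℚ <_) (+-identityʳ p) (+-monoʳ-< p (negative⁻¹ (- 1ℚ)))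

  p<p+1 : ∀ p → p < p + 1ℚ
  p<p+1 p = subst (_< p + 1ℚ) (+-identityʳ p) (+-monoʳ-< p (positive⁻¹ 1ℚ))

  neg-swapˡ : ∀ {p q} → - p < q → - q < p
  neg-swapˡ {p} {q} h = subst (- q <_) (neg-involutive p) (neg-antimono-< h)

  neg-swapʳ : ∀ {p q} → p < - q → q < - p
  neg-swapʳ {p} {q} h = subst (_< - p) (neg-involutive q) (neg-antimono-< h)

  b+a-a : ∀ a b → (b + a) - a ≡ b
  b+a-a = solve 2 (λ a b → (b :+ a) :- a := b) refl

  b-a+a : ∀ a b → (b - a) + a ≡ b
  b-a+a = solve 2 (λ a b → (b :- a) :+ a := b) refl

  square-mono-< : ∀ {p q} → 0ℚ Data.Rational.≤ p → p < q → p * p < q * q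
  square-mono-< {p} {q} 0≤p p<q =
    ≤-<-trans (*-monoˡ-≤-nonNeg p {{nonNegative 0≤p}} (<⇒≤ p<q))
              (*-monoˡ-<-pos q {{positive (≤-<-trans 0≤p p<q)}} p<q)

fromℚ : ℚ → ℝ
fromℚ a = record
  { L           = _< a
  ; U           = a <_
  ; L-inhabited = a - 1ℚ , p-1<p a
  ; U-inhabited = a + 1ℚ , p<p+1 a
  ; L-down      = <-trans
  ; U-up        = λ p<q a<p → <-trans a<p p<q
  ; L-open      = λ p<a → let m , p<m , m<a = <-dense p<a in m , p<m , m<a
  ; U-open      = λ a<q → let m , a<m , m<q = <-dense a<q in m , m<q , a<m
  ; disjoint    = <-asym
  ; located     = loc
  }
  where
  loc : ∀ {p q} → p < q → p < a ⊎ a < q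
  loc {p} {q} p<q with p <? a
  ... | yes p<a = inj₁ p<a
  ... | no  p≮a = inj₂ (≤-<-trans (≮⇒≥ p≮a) p<q)

fromℕ : ℕ → ℚ
fromℕ k = + k / 1

-ℝ_ : ℝ → ℝ
-ℝ x = record
  { L           = U ∘ -_
  ; U           = L ∘ -_
  ; L-inhabited = let u , Uu = U-inhabited in - u , subst U (sym (neg-involutive u)) Uu
  ; U-inhabited = let l , Ll = L-inhabited in - l , subst L (sym (neg-involutive l)) Ll
  ; L-down      = U-up ∘ neg-antimono-<
  ; U-up        = L-down ∘ neg-antimono-<
  ; L-open      = λ {p} h → let u , u<-p , Uu = U-open h in
                    - u , neg-swapʳ u<-p , subst U (sym (neg-involutive u)) Uu
  ; U-open      = λ {q} h → let l , -q<l , Ll = L-open h in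
                    - l , neg-swapˡ -q<l , subst L (sym (neg-involutive l)) Ll
  ; disjoint    = λ u l → disjoint l u
  ; located     = λ p<q → swap (located (neg-antimono-< p<q))
  }
  where
  open ℝ x
  swap : ∀ {A B : Set} → A ⊎ B → B ⊎ A
  swap (inj₁ a) = inj₂ a
  swap (inj₂ b) = inj₁ b

_ℚ+_ : ℚ → ℝ → ℝ
a ℚ+ x = record
  { L           = λ p → L (p - a)
  ; U           = λ p → U (p - a)
  ; L-inhabited = let l , Ll = L-inhabited in l + a , subst L (sym (b+a-a a l)) Ll
  ; U-inhabited = let u , Uu = U-inhabited in u + a , subst U (sym (b+a-a a u)) Uu
  ; L-down      = λ p<q → L-down (+-monoˡ-< (- a) p<q)
  ; U-up        = λ p<q → U-up (+-monoˡ-< (- a) p<q)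
  ; L-open      = λ {p} h → let l , p-a<l , Ll = L-open h in
                    l + a , subst (_< l + a) (b-a+a a p) (+-monoˡ-< a p-a<l)
                          , subst L (sym (b+a-a a l)) Ll
  ; U-open      = λ {q} h → let u , u<q-a , Uu = U-open h in
                    u + a , subst (u + a <_) (b-a+a a q) (+-monoˡ-< a u<q-a)
                          , subst U (sym (b+a-a a u)) Uu
  ; disjoint    = disjoint
  ; located     = λ p<q → located (+-monoˡ-< (- a) p<q)
  }
  where open ℝ x

scale⁺ : (c : ℚ) .{{_ : Positive c}} → ℝ → ℝ
scale⁺ c x = record
  { L           = λ p → L (c⁻¹ * p)
  ; U           = λ p → U (c⁻¹ * p)
  ; L-inhabited = let l , Ll = L-inhabited in c * l , subst L (sym (cancel l)) Ll
  ; U-inhabited = let u , Uu = U-inhabited in c * u , subst U (sym (cancel u)) Uu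
  ; L-down      = λ p<q → L-down (mono p<q)
  ; U-up        = λ p<q → U-up (mono p<q)
  ; L-open      = λ {p} h → let l , p/c<l , Ll = L-open h in
                    c * l , subst (_< c * l) (cancel′ p) (*-monoʳ-<-pos c p/c<l)
                          , subst L (sym (cancel l)) Ll
  ; U-open      = λ {q} h → let u , u<q/c , Uu = U-open h in
                    c * u , subst (c * u <_) (cancel′ q) (*-monoʳ-<-pos c u<q/c)
                          , subst U (sym (cancel u)) Uu
  ; disjoint    = disjoint
  ; located     = λ p<q → located (mono p<q)
  }
  where
  open ℝ x
  instance
    c≢0 : Data.Rational.NonZero c
    c≢0 = pos⇒nonZero c
  c⁻¹ : ℚ
  c⁻¹ = 1/ c
  mono : ∀ {p q} → p < q → c⁻¹ * p < c⁻¹ * q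
  mono = *-monoʳ-<-pos c⁻¹ {{1/pos⇒pos c}}
  cancel : ∀ q → c⁻¹ * (c * q) ≡ q
  cancel q = trans (sym (*-assoc c⁻¹ c q)) (trans (cong (_* q) (*-inverseˡ c)) (*-identityˡ q))
  cancel′ : ∀ q → c * (c⁻¹ * q) ≡ q
  cancel′ q = trans (sym (*-assoc c c⁻¹ q)) (trans (cong (_* q) (*-inverseʳ c)) (*-identityˡ q))

_ℚ*_ : ℚ → ℝ → ℝ
c ℚ* x with <-cmp 0ℚ c
... | tri< 0<c _ _ = scale⁺ c {{positive 0<c}} x
... | tri≈ _ _ _   = fromℚ 0ℚ
... | tri> _ _ c<0 = -ℝ scale⁺ (- c) {{positive (neg-antimono-< c<0)}} x

-- The nonnegative square root of max(x, 0).
√_ : ℝ → ℝ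
√ x = record
  { L           = L√
  ; U           = U√
  ; L-inhabited = - 1ℚ , inj₁ (negative⁻¹ (- 1ℚ))
  ; U-inhabited = U√-inhabited
  ; L-down      = L√-down
  ; U-up        = λ p<q (m , 0≤m , m<p , Um²) → m , 0≤m , <-trans m<p p<q , Um²
  ; L-open      = L√-open
  ; U-open      = λ (m , 0≤m , m<q , Um²) → let k , m<k , k<q = <-dense m<q in
                    k , k<q , m , 0≤m , m<k , Um²
  ; disjoint    = L√-U√-disjoint
  ; located     = L√-U√-located
  }
  where
  open ℝ x
  open Data.Rational using (_≤_)

  L√ U√ : ℚ → Set
  L√ p = p < 0ℚ ⊎ (∃[ m ] 0ℚ ≤ m × p < m × L (m * m))
  U√ p = ∃[ m ] 0ℚ ≤ m × m < p × U (m * m)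

  L√-down : ∀ {p q} → p < q → L√ q → L√ p
  L√-down p<q (inj₁ q<0)                   = inj₁ (<-trans p<q q<0)
  L√-down p<q (inj₂ (m , 0≤m , q<m , Lm²)) = inj₂ (m , 0≤m , <-trans p<q q<m , Lm²)

  L√-open : ∀ {p} → L√ p → ∃[ q ] p < q × L√ q
  L√-open (inj₁ p<0) = let k , p<k , k<0 = <-dense p<0 in k , p<k , inj₁ k<0
  L√-open (inj₂ (m , 0≤m , p<m , Lm²)) =
    let k , p<k , k<m = <-dense p<m in k , p<k , inj₂ (m , 0≤m , k<m , Lm²)

  L√-U√-disjoint : ∀ {q} → L√ q → ¬ U√ q
  L√-U√-disjoint (inj₁ q<0) (k , 0≤k , k<q , _) =
    <-irrefl refl (≤-<-trans 0≤k (<-trans k<q q<0))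
  L√-U√-disjoint (inj₂ (m , _ , q<m , Lm²)) (k , 0≤k , k<q , Uk²) =
    disjoint Lm² (U-up (square-mono-< 0≤k (<-trans k<q q<m)) Uk²)

  L√-U√-located : ∀ {p q} → p < q → L√ p ⊎ U√ q
  L√-U√-located {p} {q} p<q with <-dense p<q
  ... | b , p<b , b<q with <-dense p<b
  ... | a , p<a , a<b with a <? 0ℚ
  ... | yes a<0 = inj₁ (inj₁ (<-trans p<a a<0))
  ... | no  a≮0 with located (square-mono-< (≮⇒≥ a≮0) a<b)
  ... | inj₁ La² = inj₁ (inj₂ (a , ≮⇒≥ a≮0 , p<a , La²))
  ... | inj₂ Ub² = inj₂ (b , ≤-trans (≮⇒≥ a≮0) (<⇒≤ a<b) , b<q , Ub²)

  U√-inhabited : ∃ U√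
  U√-inhabited with U-inhabited
  ... | u , Uu with u <? 1ℚ
  ... | yes u<1 = 1ℚ + 1ℚ , 1ℚ , <⇒≤ (positive⁻¹ 1ℚ) , p<p+1 1ℚ , U-up u<1 Uu
  ... | no  u≮1 = w + 1ℚ , w , <⇒≤ 0<w , p<p+1 w , U-up u<w² Uu
    where
    w = u + 1ℚ
    1<w : 1ℚ < w
    1<w = ≤-<-trans (≮⇒≥ u≮1) (p<p+1 u)
    0<w : 0ℚ < w
    0<w = <-trans (positive⁻¹ 1ℚ) 1<w
    u<w² : u < w * w
    u<w² = <-trans (p<p+1 u) (subst (_< w * w) (*-identityʳ w) (*-monoʳ-<-pos w {{positive 0<w}} 1<w))

------------------------------------------------------------------------
-- Finite simple graphs

record Graph (V : Set) : Set₁ where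
  field
    Adj    : Rel V 0ℓ
    adj?   : Decidable Adj
    symm   : Symmetric Adj
    irrefl : Irreflexive _≡_ Adj

open Graph

K : (s : ℕ) → Graph (Fin s)
K s = record
  { Adj    = _≢_
  ; adj?   = λ i j → ¬? (i Fin.≟ j)
  ; symm   = λ i≢j → i≢j ∘ sym
  ; irrefl = λ i≡j i≢j → i≢j i≡j
  }

infix 4 _⊑_

-- H is isomorphic to a (not necessarily induced) subgraph of G.
_⊑_ : ∀ {W V} → Graph W → Graph V → Set
_⊑_ {W} {V} H G =
  Σ[ f ∈ (W → V) ] Injective _≡_ _≡_ f × (∀ i j → Adj H i j → Adj G (f i) (f j))

KFree : ∀ {V} → ℕ → Graph V → Set
KFree s G = ¬ (K s ⊑ G)

edgeCount : ∀ {n} → Graph (Fin n) → ℕ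
edgeCount {n} G =
  length (filter (λ (i , j) → (i Fin.<? j) ×-dec adj? G i j)
                 (cartesianProduct (allFin n) (allFin n)))

_[_] : ∀ {n} → Graph (Fin n) → (S : Subset n) → Graph (∃ (_∈ S))
G [ S ] = record
  { Adj    = λ u v → Adj G (proj₁ u) (proj₁ v)
  ; adj?   = λ u v → adj? G (proj₁ u) (proj₁ v)
  ; symm   = symm G
  ; irrefl = irrefl G ∘ cong proj₁
  }

IsKIndependenceNumber : ∀ {n} → ℕ → Graph (Fin n) → ℕ → Set
IsKIndependenceNumber s G α =
  (∃[ S ] ∣ S ∣ ≡ α × KFree s (G [ S ])) × (∀ S → KFree s (G [ S ]) → ∣ S ∣ ℕ.≤ α)

-- For s = 0 no subgraph is K₀-free, hence the hypothesis on s.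
kIndependenceNumber-exists :
  ∀ {n} s .{{_ : NonZero s}} (G : Graph (Fin n)) → ∃ (IsKIndependenceNumber s G)
kIndependenceNumber-exists {n} (suc s) G = search n λ S _ → ∣p∣≤n S
  where
  Clique : Subset n → (Fin (suc s) → Fin n) → Set
  Clique S g = (∀ i → g i ∈ S) × (∀ i j → i ≢ j → Adj G (g i) (g j))

  clique? : ∀ S g → Dec (Clique S g)
  clique? S g = Fin.all? (λ i → g i ∈? S)
    ×-dec Fin.all? (λ i → Fin.all? (λ j → ¬? (i Fin.≟ j) →-dec adj? G (g i) (g j)))

  to : ∀ S → ∃ (λ k → Clique S (finToFun k)) → K (suc s) ⊑ (G [ S ])
  to S (k , g∈S , g-adj) = (λ i → finToFun k i , g∈S i) , inj , g-adj
    where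
    inj : Injective _≡_ _≡_ (λ i → finToFun k i , g∈S i)
    inj {i} {j} e with i Fin.≟ j
    ... | yes i≡j = i≡j
    ... | no  i≢j = ⊥-elim (irrefl G (cong proj₁ e) (g-adj i j i≢j))

  from : ∀ S → K (suc s) ⊑ (G [ S ]) → ∃ (λ k → Clique S (finToFun k))
  from S (f , _ , f-adj) = funToFin g ,
    (λ i → subst (_∈ S) (sym (eq i)) (proj₂ (f i))) ,
    (λ i j i≢j → subst₂ (Adj G) (sym (eq i)) (sym (eq j)) (f-adj i j i≢j))
    where
    g = proj₁ ∘ f
    eq = Fin.finToFun-funToFin g

  free? : ∀ S → Dec (KFree (suc s) (G [ S ]))
  free? S = ¬? (map′ (to S) (from S) (Fin.any? (λ k → clique? S (finToFun k))))

  search : ∀ b → (∀ S → KFree (suc s) (G [ S ]) → ∣ S ∣ ℕ.≤ b) → ∃ (IsKIndependenceNumber (suc s) G)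
  search b bound with anySubset? (λ S → (∣ S ∣ ℕ.≟ b) ×-dec free? S)
  search b bound       | yes w = b , w , bound
  search zero bound    | no ¬w = contradiction
    (∅ , ∣⊥∣≡0 n , λ (f , _) → ∉⊥ (proj₂ (f Fin.zero))) ¬w
  search (suc b) bound | no ¬w = search b λ S free →
    ℕ.≤-pred (ℕ.≤∧≢⇒< (bound S free) λ eq → ¬w (S , eq , free))

------------------------------------------------------------------------
-- The quantities of the bound. The proof of 3 ≤ r serves only to make the
-- denominators nonzero; truncated subtraction is exact when 2 ≤ s ≤ r.

r∸1-nonZero : ∀ {r} → 3 ℕ.≤ r → NonZero (r ℕ.∸ 1)
r∸1-nonZero (s≤s (s≤s _)) = _

-- (r - 2) / (2 (r - 1))
halfTuránDensity : (r : ℕ) → 3 ℕ.≤ r → ℚ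
halfTuránDensity r 3≤r =
  (+ (r ℕ.∸ 2) / (2 ℕ.* (r ℕ.∸ 1))) {{ℕ.m*n≢0 2 (r ℕ.∸ 1) {{_}} {{r∸1-nonZero 3≤r}}}}

-- (s - 1) / (r - 1)
partRatio : (r s : ℕ) → 3 ℕ.≤ r → ℚ
partRatio r s 3≤r = (+ (s ℕ.∸ 1) / (r ℕ.∸ 1)) {{r∸1-nonZero 3≤r}}

d : (r s : ℕ) → 3 ℕ.≤ r → ℝ → ℝ
d r s 3≤r γ =
  √ ((+ (2 ℕ.* (s ℕ.∸ 1) ℕ.* (r ℕ.∸ s)) / (r ℕ.∸ 1)) {{r∸1-nonZero 3≤r}}
      ℚ* (halfTuránDensity r 3≤r ℚ+ (-ℝ γ)))

{-# OPTIONS --safe #-}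
-- Let S be a Kₛ-free set of α vertices in a K_r-free graph with n vertices and e edges, and put
-- σ = s - 1, ρ = r - s, τ = r - 1 = σ + ρ and β = n - α. For vertex costs c, a vertex v
-- maximising c(v) + deg v satisfies
--   2 Σ c - #{nonadjacent ordered pairs} ≤ c(v)² + (the same quantity on the neighbours of v),
-- so iterating bounds the left side by Σ c² over a clique. That clique has at most σ + ρ vertices,
-- at most σ of them in S; with c = α/σ on S and c = β/ρ off S this gives, when β/ρ ≤ α/σ,
--   2 e ≤ n² - α²/σ - β²/ρ = n² (1 - 1/τ) - (α - σ n/τ)² τ/(σ ρ).
-- As γ n² ≤ e, the excess α/n - σ/τ is at most d(s).
module Submission where

open import Defs
open import Data.Fin using (Fin)
open import Data.Nat using (ℕ; _≤_; _*_)
open import Data.Rational using (0ℚ)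

open import Data.Bool using (true; false; if_then_else_)
import Data.Fin as Fin
import Data.Fin.Properties as Fin
open import Data.Fin.Subset using (Subset; inside; outside) renaming (_∈_ to _∈ˢ_; ∣_∣ to ∣_∣ˢ)
open import Data.Fin.Subset.Properties using (∣p∣≤n) renaming (_∈?_ to _∈ˢ?_)
import Data.Integer as ℤ
import Data.Integer.Properties as ℤ
import Data.Integer.Tactic.RingSolver as ℤ
open import Data.List using (List; []; _∷_; _++_; map; length; filter; lookup; allFin; tabulate; cartesianProduct)
open import Data.List.Extrema.Nat using (argmax; argmax-sel; f[⊥]≤f[argmax]; f[xs]≤f[argmax])
open import Data.List.Membership.Propositional using (_∈_; lose)
open import Data.List.Membership.Propositional.Properties using (∈-filter⁻; ∈-lookup)
open import Data.List.Properties using (map-++; map-∘; map-cong; map-tabulate; length-tabulate; filter-notAll)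
open import Data.List.Relation.Unary.All using (All; []; _∷_)
import Data.List.Relation.Unary.All as All
open import Data.List.Relation.Unary.All.Properties using (all-filter; filter⁺)
open import Data.List.Relation.Unary.AllPairs using (AllPairs; []; _∷_)
import Data.List.Relation.Unary.AllPairs.Properties as AllPairs
open import Data.List.Relation.Unary.Any using (here; there)
open import Data.Nat using (zero; suc; _+_; _∸_; _<_; z≤n; s≤s; NonZero; >-nonZero)
open import Data.Nat.ListAction using (sum)
open import Data.Nat.ListAction.Properties using (sum-++)
open import Data.Nat.Properties
open import Data.Nat.Tactic.RingSolver using (solve-∀)
open import Data.Product using (_×_; _,_; ∃; ∃-syntax; proj₁; proj₂)
open import Data.Rational as ℚ using (ℚ; 1ℚ; Positive; positive; nonNegative; 1/_; _/_; toℚᵘ; fromℚᵘ)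
import Data.Rational.Properties as ℚ
open import Data.Rational.Solver using (module +-*-Solver)
open import Data.Rational.Unnormalised as ℚᵘ using (mkℚᵘ; *≡*; *≤*)
import Data.Rational.Unnormalised.Properties as ℚᵘ
open import Data.Sum using (inj₁; inj₂; fromInj₂)
open import Data.Vec using ([]; _∷_)
open import Function using (_∘_)
open import Level using (0ℓ)
open import Relation.Binary.Core using (Rel)
open import Relation.Binary.Definitions using (Symmetric; tri<; tri≈; tri>)
open import Relation.Binary.PropositionalEquality hiding ([_])
import Relation.Binary.Reasoning.Setoid as SetoidReasoning
open import Relation.Nullary using (Dec; yes; no; does; contradiction)
open import Relation.Nullary.Decidable using (¬?; _×-dec_)
open import Relation.Unary using (Decidable)

-- Finite sums over lists.

indicator : {P : Set} → Dec P → ℕ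
indicator p = if does p then 1 else 0

module _ {A : Set} where

  ∑ : List A → (A → ℕ) → ℕ
  ∑ L f = sum (map f L)

  ∑-cong : ∀ L {f g : A → ℕ} → (∀ x → f x ≡ g x) → ∑ L f ≡ ∑ L g
  ∑-cong L f≗g = cong sum (map-cong f≗g L)

  ∑-distrib-+ : ∀ L (f g : A → ℕ) → ∑ L (λ x → f x + g x) ≡ ∑ L f + ∑ L g
  ∑-distrib-+ []      f g = refl
  ∑-distrib-+ (x ∷ L) f g rewrite ∑-distrib-+ L f g = interchange (f x) (g x) (∑ L f) (∑ L g)
    where
    interchange : ∀ a b c d → a + b + (c + d) ≡ a + c + (b + d)
    interchange = solve-∀

  *-distribˡ-∑ : ∀ k L (f : A → ℕ) → ∑ L (λ x → k * f x) ≡ k * ∑ L f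
  *-distribˡ-∑ k []      f = sym (*-zeroʳ k)
  *-distribˡ-∑ k (x ∷ L) f rewrite *-distribˡ-∑ k L f = sym (*-distribˡ-+ k (f x) (∑ L f))

  ∑-const : ∀ L k → ∑ L (λ _ → k) ≡ length L * k
  ∑-const []      k = refl
  ∑-const (_ ∷ L) k = cong (k +_) (∑-const L k)

  ∑-mono : ∀ {L} {f g : A → ℕ} → All (λ x → f x ≤ g x) L → ∑ L f ≤ ∑ L g
  ∑-mono []       = z≤n
  ∑-mono (p ∷ ps) = +-mono-≤ p (∑-mono ps)

  module _ {P : A → Set} (P? : Decidable P) where

    ∑-partition : ∀ L f → ∑ L f ≡ ∑ (filter P? L) f + ∑ (filter (¬? ∘ P?) L) f
    ∑-partition []      f = refl
    ∑-partition (x ∷ L) f rewrite ∑-partition L f with does (P? x)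
    ... | true  = sym (+-assoc (f x) _ _)
    ... | false = left-comm (f x) (∑ (filter P? L) f) (∑ (filter (¬? ∘ P?) L) f)
      where
      left-comm : ∀ a b c → a + (b + c) ≡ b + (a + c)
      left-comm = solve-∀

    length-filter-∑ : ∀ L → length (filter P? L) ≡ ∑ L (indicator ∘ P?)
    length-filter-∑ []      = refl
    length-filter-∑ (x ∷ L) with does (P? x)
    ... | true  = cong suc (length-filter-∑ L)
    ... | false = length-filter-∑ L

∑-++ : ∀ {A : Set} (L M : List A) f → ∑ (L ++ M) f ≡ ∑ L f + ∑ M f
∑-++ L M f = trans (cong sum (map-++ f L M)) (sum-++ (map f L) (map f M))

∑-swap : ∀ {A B : Set} (L : List A) (M : List B) (f : A → B → ℕ) →
  ∑ L (λ x → ∑ M (f x)) ≡ ∑ M (λ y → ∑ L (λ x → f x y))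
∑-swap []      M f = sym (trans (∑-const M 0) (*-zeroʳ (length M)))
∑-swap (x ∷ L) M f = trans (cong (∑ M (f x) +_) (∑-swap L M f))
                           (sym (∑-distrib-+ M (f x) (λ y → ∑ L (λ x → f x y))))

∑-cartesianProduct : ∀ {A B : Set} (L : List A) (M : List B) (f : A × B → ℕ) →
  ∑ (cartesianProduct L M) f ≡ ∑ L (λ x → ∑ M (λ y → f (x , y)))
∑-cartesianProduct []      M f = refl
∑-cartesianProduct (x ∷ L) M f =
  trans (∑-++ (map (x ,_) M) (cartesianProduct L M) f)
        (cong₂ _+_ (cong sum (sym (map-∘ M))) (∑-cartesianProduct L M f))

-- Writing the larger number as the smaller plus `k`, the two sides differ by `k * k`; this avoids
-- subtraction in ℕ.
2xy≤x²+y² : ∀ x y → 2 * (x * y) ≤ x * x + y * y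
2xy≤x²+y² x y with ≤-total x y
... | inj₁ x≤y with k , refl ← m≤n⇒∃[o]m+o≡n x≤y =
  m+n≤o⇒m≤o _ (≤-reflexive (expand x k))
  where
  expand : ∀ x k → 2 * (x * (x + k)) + k * k ≡ x * x + (x + k) * (x + k)
  expand = solve-∀
... | inj₂ y≤x with k , refl ← m≤n⇒∃[o]m+o≡n y≤x =
  m+n≤o⇒m≤o _ (≤-reflexive (expand y k))
  where
  expand : ∀ y k → 2 * ((y + k) * y) + k * k ≡ (y + k) * (y + k) + y * y
  expand = solve-∀

-- Greedy construction of a clique that bounds the number of nonadjacent pairs.

module _ {V : Set} (G : Graph V) where
  open Graph G
  open ≤-Reasoning

  nonadj : V → V → ℕ
  nonadj u v = indicator (¬? (adj? u v))

  nonadj-sym : ∀ u v → nonadj u v ≡ nonadj v u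
  nonadj-sym u v with adj? u v | adj? v u
  ... | yes _  | yes _  = refl
  ... | no _   | no _   = refl
  ... | yes uv | no ¬vu = contradiction (symm uv) ¬vu
  ... | no ¬uv | yes vu = contradiction (symm vu) ¬uv

  deg codeg : List V → V → ℕ
  deg   L v = ∑ L (indicator ∘ adj? v)
  codeg L v = ∑ L (nonadj v)

  deg+codeg : ∀ L v → deg L v + codeg L v ≡ length L
  deg+codeg []      v = refl
  deg+codeg (u ∷ L) v with does (adj? v u)
  ... | true  = cong suc (deg+codeg L v)
  ... | false = trans (+-suc (deg L v) (codeg L v)) (cong suc (deg+codeg L v))

  -- Pairs are ordered and the diagonal is included, because no vertex is adjacent to itself.
  nonedges : List V → ℕ
  nonedges L = ∑ L (codeg L)

  codeg≤length : ∀ L v → codeg L v ≤ length L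
  codeg≤length L v = m+n≤o⇒n≤o (deg L v) (≤-reflexive (deg+codeg L v))

  -- The cost of `u` is to be read as the fraction `c u / D`: the common denominator `D` keeps the
  -- argument in ℕ. So `v` maximises cost plus degree.
  module _ (c : V → ℕ) (D : ℕ) (L : List V) (v : V)
           (v-max : All (λ u → c u + D * deg L u ≤ c v + D * deg L v) L) where

    private
      N A : List V
      N = filter (adj? v) L
      A = filter (¬? ∘ adj? v) L

      t : ℕ
      t = length A

      t≡codeg : t ≡ codeg L v
      t≡codeg = length-filter-∑ (¬? ∘ adj? v) L

    -- The nonadjacent pairs that meet `A` are counted by first and by second entry, and those
    -- inside `A` are thereby counted twice. The correction stands on the left to avoid subtraction.
    nonedges-split : nonedges L + ∑ A (codeg A) ≡ nonedges N + 2 * ∑ A (codeg L)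
    nonedges-split = begin-equality
      ∑ L (codeg L) + ∑ A (codeg A)
        ≡⟨ cong (_+ ∑ A (codeg A)) (∑-partition (adj? v) L (codeg L)) ⟩
      ∑ N (codeg L) + ∑ A (codeg L) + ∑ A (codeg A)
        ≡⟨ cong (λ x → x + ∑ A (codeg L) + ∑ A (codeg A)) (split N) ⟩
      ∑ N (codeg N) + ∑ N (codeg A) + ∑ A (codeg L) + ∑ A (codeg A)
        ≡⟨ cong (λ x → ∑ N (codeg N) + x + ∑ A (codeg L) + ∑ A (codeg A)) cross ⟩
      ∑ N (codeg N) + ∑ A (codeg N) + ∑ A (codeg L) + ∑ A (codeg A)
        ≡⟨ regroup (∑ N (codeg N)) (∑ A (codeg N)) (∑ A (codeg L)) (∑ A (codeg A)) ⟩
      ∑ N (codeg N) + (∑ A (codeg L) + (∑ A (codeg N) + ∑ A (codeg A)))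
        ≡⟨ cong (λ x → ∑ N (codeg N) + (∑ A (codeg L) + x)) (split A) ⟨
      ∑ N (codeg N) + (∑ A (codeg L) + ∑ A (codeg L))
        ≡⟨ cong (λ x → ∑ N (codeg N) + (∑ A (codeg L) + x)) (+-identityʳ (∑ A (codeg L))) ⟨
      ∑ N (codeg N) + 2 * ∑ A (codeg L) ∎
      where
      split : ∀ M → ∑ M (codeg L) ≡ ∑ M (codeg N) + ∑ M (codeg A)
      split M = trans (∑-cong M λ u → ∑-partition (adj? v) L (nonadj u))
                      (∑-distrib-+ M (codeg N) (codeg A))
      cross : ∑ N (codeg A) ≡ ∑ A (codeg N)
      cross = trans (∑-swap N A nonadj)
                    (∑-cong A λ u → ∑-cong N λ w → nonadj-sym w u)
      regroup : ∀ a b c d → a + b + c + d ≡ a + (c + (b + d))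
      regroup = solve-∀

    -- Degree and codegree add up to the length of `L`, so maximality of cost plus degree is
    -- maximality of cost minus codegree; `t` is the codegree of `v`.
    codeg-min : ∀ {u} → c u + D * deg L u ≤ c v + D * deg L v → c u + D * t ≤ c v + D * codeg L u
    codeg-min {u} h = +-cancelʳ-≤ (D * length L) _ _ (begin
      c u + D * t + D * length L
        ≡⟨ cong₂ (λ x y → c u + D * x + D * y) t≡codeg (sym (deg+codeg L u)) ⟩
      c u + D * codeg L v + D * (deg L u + codeg L u)
        ≡⟨ regroup₁ (c u) D (codeg L v) (deg L u) (codeg L u) ⟩
      (c u + D * deg L u) + (D * codeg L v + D * codeg L u)
        ≤⟨ +-monoˡ-≤ _ h ⟩
      (c v + D * deg L v) + (D * codeg L v + D * codeg L u)
        ≡⟨ regroup₂ (c v) D (deg L v) (codeg L v) (codeg L u) ⟩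
      c v + D * codeg L u + D * (deg L v + codeg L v)
        ≡⟨ cong (λ x → c v + D * codeg L u + D * x) (deg+codeg L v) ⟩
      c v + D * codeg L u + D * length L ∎)
      where
      regroup₁ : ∀ a D x y z → a + D * x + D * (y + z) ≡ (a + D * y) + (D * x + D * z)
      regroup₁ = solve-∀
      regroup₂ : ∀ a D x y z → (a + D * x) + (D * y + D * z) ≡ a + D * z + D * (x + y)
      regroup₂ = solve-∀

    ∑-codeg-min : ∑ A c + t * (D * t) ≤ t * c v + D * ∑ A (codeg L)
    ∑-codeg-min = begin
      ∑ A c + t * (D * t)                        ≡⟨ cong (∑ A c +_) (∑-const A (D * t)) ⟨
      ∑ A c + ∑ A (λ _ → D * t)                  ≡⟨ ∑-distrib-+ A c (λ _ → D * t) ⟨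
      ∑ A (λ u → c u + D * t)                    ≤⟨ ∑-mono (All.map codeg-min (filter⁺ (¬? ∘ adj? v) v-max)) ⟩
      ∑ A (λ u → c v + D * codeg L u)            ≡⟨ ∑-distrib-+ A (λ _ → c v) (λ u → D * codeg L u) ⟩
      ∑ A (λ _ → c v) + ∑ A (λ u → D * codeg L u) ≡⟨ cong₂ _+_ (∑-const A (c v)) (*-distribˡ-∑ D A (codeg L)) ⟩
      t * c v + D * ∑ A (codeg L)                ∎

    -- Passing from `L` to `N` loses `2X - Y` nonadjacent pairs. By `∑-codeg-min` and `Y ≤ t²`, this
    -- number times `D²` is at least `2DC + (Dt)² - 2Dt c(v)`, and completing the square leaves at
    -- least `2DC - c(v)²`.
    greedy-step : 2 * D * ∑ A c + D * D * nonedges N ≤ D * D * nonedges L + c v * c v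
    greedy-step = +-cancelʳ-≤ (D * D * Y + 2 * (D * t * (D * t))) _ _ (begin
      2 * D * C + D * D * nonedges N + (D * D * Y + 2 * (D * t * (D * t)))
        ≡⟨ regroup₁ D C (nonedges N) Y t ⟩
      2 * D * (C + t * (D * t)) + (D * D * nonedges N + D * D * Y)
        ≤⟨ +-monoˡ-≤ _ (*-monoʳ-≤ (2 * D) ∑-codeg-min) ⟩
      2 * D * (t * c v + D * X) + (D * D * nonedges N + D * D * Y)
        ≡⟨ regroup₂ D (c v) X (nonedges N) Y t ⟩
      2 * (D * t * c v) + D * D * (nonedges N + 2 * X) + D * D * Y
        ≡⟨ cong (λ x → 2 * (D * t * c v) + D * D * x + D * D * Y) nonedges-split ⟨
      2 * (D * t * c v) + D * D * (nonedges L + Y) + D * D * Y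
        -- Each of the two estimates uses one of the two copies of `(Dt)²` that are cancelled at the
        -- end.
        ≤⟨ +-mono-≤ (+-monoˡ-≤ _ (2xy≤x²+y² (D * t) (c v))) (*-monoʳ-≤ (D * D) Y≤t²) ⟩
      D * t * (D * t) + c v * c v + D * D * (nonedges L + Y) + D * D * (t * t)
        ≡⟨ regroup₃ D (c v) (nonedges L) Y t ⟩
      D * D * nonedges L + c v * c v + (D * D * Y + 2 * (D * t * (D * t))) ∎)
      where
      C X Y : ℕ
      C = ∑ A c
      X = ∑ A (codeg L)
      Y = ∑ A (codeg A)
      Y≤t² : Y ≤ t * t
      Y≤t² = ≤-trans (∑-mono (All.universal (codeg≤length A) A)) (≤-reflexive (∑-const A t))
      regroup₁ : ∀ D C P Y t → 2 * D * C + D * D * P + (D * D * Y + 2 * (D * t * (D * t)))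
        ≡ 2 * D * (C + t * (D * t)) + (D * D * P + D * D * Y)
      regroup₁ = solve-∀
      regroup₂ : ∀ D c X P Y t → 2 * D * (t * c + D * X) + (D * D * P + D * D * Y)
        ≡ 2 * (D * t * c) + D * D * (P + 2 * X) + D * D * Y
      regroup₂ = solve-∀
      regroup₃ : ∀ D c P Y t → D * t * (D * t) + c * c + D * D * (P + Y) + D * D * (t * t)
        ≡ D * D * P + c * c + (D * D * Y + 2 * (D * t * (D * t)))
      regroup₃ = solve-∀

  ∃-max : ∀ (f : V → ℕ) x L → ∃[ v ] v ∈ (x ∷ L) × All (λ u → f u ≤ f v) (x ∷ L)
  ∃-max f x L = argmax f x L , sel , f[⊥]≤f[argmax] {f = f} x L ∷ f[xs]≤f[argmax] {f = f} x L
    where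
    sel : argmax f x L ∈ x ∷ L
    sel with argmax-sel f x L
    ... | inj₁ eq = here eq
    ... | inj₂ v∈L = there v∈L

  -- Choose a maximiser `v`, restrict to its neighbours and repeat until no vertex is left. The
  -- chosen vertices are pairwise adjacent, and by `greedy-step` each of them contributes the square
  -- of its cost.
  clique-bound : ∀ (c : V → ℕ) D L → ∃[ Q ] AllPairs Adj Q × All (_∈ L) Q ×
    2 * D * ∑ L c ≤ D * D * nonedges L + ∑ Q (λ v → c v * c v)
  clique-bound c D L = go (length L) L ≤-refl
    where
    go : ∀ k L → length L ≤ k → ∃[ Q ] AllPairs Adj Q × All (_∈ L) Q ×
      2 * D * ∑ L c ≤ D * D * nonedges L + ∑ Q (λ v → c v * c v)
    go _ [] _ = [] , [] , [] , ≤-trans (≤-reflexive (*-zeroʳ (2 * D))) z≤n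
    go (suc k) L@(x ∷ xs) (s≤s ≤k) with ∃-max (λ u → c u + D * deg L u) x xs
    ... | v , v∈L , v-max
      -- The list gets strictly shorter because `v` is not its own neighbour; `k` bounds its length
      -- and drives the recursion.
      with go k (filter (adj? v) L) (≤-trans (≤-pred (filter-notAll (adj? v) L (lose v∈L (irrefl refl)))) ≤k)
    ... | Q , Q-clique , Q⊆N , bound =
      v ∷ Q , All.map (λ u∈N → proj₂ (∈-filter⁻ (adj? v) {xs = L} u∈N)) Q⊆N ∷ Q-clique ,
      v∈L ∷ All.map (λ u∈N → proj₁ (∈-filter⁻ (adj? v) u∈N)) Q⊆N , (begin
        2 * D * ∑ L c
          ≡⟨ cong (2 * D *_) (∑-partition (adj? v) L c) ⟩
        2 * D * (∑ N c + ∑ A c)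
          ≡⟨ *-distribˡ-+ (2 * D) (∑ N c) (∑ A c) ⟩
        2 * D * ∑ N c + 2 * D * ∑ A c
          ≤⟨ +-monoˡ-≤ _ bound ⟩
        D * D * nonedges N + R + 2 * D * ∑ A c
          ≡⟨ regroup (D * D * nonedges N) R (2 * D * ∑ A c) ⟩
        2 * D * ∑ A c + D * D * nonedges N + R
          ≤⟨ +-monoˡ-≤ R (greedy-step c D L v v-max) ⟩
        D * D * nonedges L + c v * c v + R
          ≡⟨ +-assoc (D * D * nonedges L) (c v * c v) R ⟩
        D * D * nonedges L + (c v * c v + R) ∎)
      where
      N A : List V
      N = filter (adj? v) L
      A = filter (¬? ∘ adj? v) L
      R : ℕ
      R = ∑ Q (λ v → c v * c v)
      regroup : ∀ a b c → a + b + c ≡ c + a + b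
      regroup = solve-∀

-- Sums of two-valued costs, and cliques as copies of complete graphs.

module _ {A : Set} {P : A → Set} (P? : Decidable P) where

  length-filter-∁ : ∀ L → length (filter P? L) + length (filter (¬? ∘ P?) L) ≡ length L
  length-filter-∁ []      = refl
  length-filter-∁ (x ∷ L) with does (P? x)
  ... | true  = cong suc (length-filter-∁ L)
  ... | false = trans (+-suc (length (filter P? L)) _) (cong suc (length-filter-∁ L))

  ∑-if : ∀ L p q → ∑ L (λ x → if does (P? x) then p else q) ≡
         length (filter P? L) * p + length (filter (¬? ∘ P?) L) * q
  ∑-if []      p q = refl
  ∑-if (x ∷ L) p q rewrite ∑-if L p q with does (P? x)
  ... | true  = sym (+-assoc p _ _)
  ... | false = left-comm (length (filter P? L) * p) q _
    where
    left-comm : ∀ a b c → b + (a + c) ≡ a + (b + c)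
    left-comm = solve-∀

AllPairs-lookup : ∀ {A : Set} {R : Rel A 0ℓ} → Symmetric R → ∀ {L} → AllPairs R L →
  ∀ i j → i ≢ j → R (lookup L i) (lookup L j)
AllPairs-lookup R-sym (_  ∷ _)  Fin.zero    Fin.zero    i≢j = contradiction refl i≢j
AllPairs-lookup R-sym (Rx ∷ _)  Fin.zero    (Fin.suc j) _   = All.lookup Rx (∈-lookup j)
AllPairs-lookup R-sym (Rx ∷ _)  (Fin.suc i) Fin.zero    _   = R-sym (All.lookup Rx (∈-lookup i))
AllPairs-lookup R-sym (_  ∷ Rs) (Fin.suc i) (Fin.suc j) i≢j = AllPairs-lookup R-sym Rs i j (i≢j ∘ cong Fin.suc)

module _ {V : Set} (G : Graph V) where
  open Graph G

  -- The first `s` entries of `Q` form the copy. Entries at distinct positions are adjacent, so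
  -- irreflexivity makes them distinct.
  clique⇒K⊑ : ∀ {s Q} → AllPairs Adj Q → s ≤ length Q → K s ⊑ G
  clique⇒K⊑ {s} {Q} Q-clique s≤∣Q∣ = f , f-injective , f-adj
    where
    f : Fin s → V
    f i = lookup Q (Fin.inject≤ i s≤∣Q∣)
    f-adj : ∀ i j → i ≢ j → Adj (f i) (f j)
    f-adj i j i≢j = AllPairs-lookup symm Q-clique _ _ (i≢j ∘ Fin.inject≤-injective s≤∣Q∣ s≤∣Q∣ i j)
    f-injective : ∀ {i j} → f i ≡ f j → i ≡ j
    f-injective {i} {j} eq with i Fin.≟ j
    ... | yes i≡j = i≡j
    ... | no  i≢j = contradiction (f-adj i j i≢j) (irrefl eq)

  KFree⇒clique≤ : ∀ {s Q} → KFree (suc s) G → AllPairs Adj Q → length Q ≤ s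
  KFree⇒clique≤ free Q-clique = ≮⇒≥ (free ∘ clique⇒K⊑ Q-clique)

filter-∈-length : ∀ {n} (S : Subset n) → length (filter (_∈ˢ? S) (allFin n)) ≡ ∣ S ∣ˢ
filter-∈-length {n} S = trans (length-filter-∑ (_∈ˢ? S) (allFin n))
  (trans (cong sum (map-tabulate {n = n} (λ i → i) (indicator ∘ (_∈ˢ? S)))) (∑-∈ S))
  where
  ∑-∈ : ∀ {n} (S : Subset n) → sum (tabulate (λ i → indicator (i ∈ˢ? S))) ≡ ∣ S ∣ˢ
  ∑-∈ []            = refl
  ∑-∈ (inside ∷ S)  = cong suc (∑-∈ S)
  ∑-∈ (outside ∷ S) = ∑-∈ S

-- Of at most `σ + ρ` items, at most `σ` may carry the larger weight `a`, so the extreme case has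
-- exactly `σ` and `ρ` items. Here `z = σ - x` items are raised from `b` to `a`.
shift-weight : ∀ {x y σ ρ a b} → x ≤ σ → x + y ≤ σ + ρ → b ≤ a → x * a + y * b ≤ σ * a + ρ * b
shift-weight {x} {y} {ρ = ρ} {a} {b} x≤σ x+y≤σ+ρ b≤a with z , refl ← m≤n⇒∃[o]m+o≡n x≤σ = begin
  x * a + y * b            ≤⟨ +-monoʳ-≤ (x * a) (*-monoˡ-≤ b y≤z+ρ) ⟩
  x * a + (z + ρ) * b      ≡⟨ cong (x * a +_) (*-distribʳ-+ b z ρ) ⟩
  x * a + (z * b + ρ * b)  ≤⟨ +-monoʳ-≤ (x * a) (+-monoˡ-≤ _ (*-monoʳ-≤ z b≤a)) ⟩
  x * a + (z * a + ρ * b)  ≡⟨ +-assoc (x * a) (z * a) (ρ * b) ⟨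
  x * a + z * a + ρ * b    ≡⟨ cong (_+ ρ * b) (*-distribʳ-+ a x z) ⟨
  (x + z) * a + ρ * b      ∎
  where
  open ≤-Reasoning
  y≤z+ρ : y ≤ z + ρ
  y≤z+ρ = +-cancelˡ-≤ x y (z + ρ) (≤-trans x+y≤σ+ρ (≤-reflexive (+-assoc x z ρ)))

-- The bound on the number of edges.

module _ {n : ℕ} (G : Graph (Fin n)) where
  open Graph G
  open ≤-Reasoning

  -- Vertices of `G [ S ]` carry membership proofs, so the clique is first lifted to that graph,
  -- with the same length.
  KFree-[]⇒clique≤ : ∀ {s S Q} → KFree (suc s) (G [ S ]) → AllPairs Adj Q → All (_∈ˢ S) Q → length Q ≤ s
  KFree-[]⇒clique≤ {S = S} {Q} free Q-clique Q⊆S =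
    subst (_≤ _) (length-attach Q⊆S) (KFree⇒clique≤ (G [ S ]) free (attach-clique Q-clique Q⊆S))
    where
    attach : ∀ {Q} → All (_∈ˢ S) Q → List (∃ (_∈ˢ S))
    attach []           = []
    attach (u∈S ∷ Q⊆S) = (_ , u∈S) ∷ attach Q⊆S
    length-attach : ∀ {Q} (Q⊆S : All (_∈ˢ S) Q) → length (attach Q⊆S) ≡ length Q
    length-attach []          = refl
    length-attach (_ ∷ Q⊆S) = cong suc (length-attach Q⊆S)
    attach-All : ∀ {P : Fin n → Set} {Q} → All P Q → (Q⊆S : All (_∈ˢ S) Q) → All (P ∘ proj₁) (attach Q⊆S)
    attach-All []       []         = []
    attach-All (p ∷ ps) (_ ∷ Q⊆S) = p ∷ attach-All ps Q⊆S
    attach-clique : ∀ {Q} → AllPairs Adj Q → (Q⊆S : All (_∈ˢ S) Q) → AllPairs (Graph.Adj (G [ S ])) (attach Q⊆S)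
    attach-clique []       []         = []
    attach-clique (r ∷ rs) (_ ∷ Q⊆S) = attach-All r Q⊆S ∷ attach-clique rs Q⊆S

  -- Every ordered pair is an ascending edge, a descending edge or nonadjacent, and swapping the
  -- order of summation identifies the first two counts.
  2*edgeCount+nonedges : 2 * edgeCount G + nonedges G (allFin n) ≡ n * n
  2*edgeCount+nonedges = begin-equality
    2 * edgeCount G + nonedges G I
      ≡⟨ cong (λ x → edgeCount G + x + nonedges G I) (+-identityʳ (edgeCount G)) ⟩
    edgeCount G + edgeCount G + nonedges G I
      ≡⟨ cong (λ x → x + x + nonedges G I) edgeCount≡∑∑ ⟩
    ∑∑ up + ∑∑ up + ∑∑ (nonadj G)
      ≡⟨ cong (λ x → ∑∑ up + x + ∑∑ (nonadj G)) (∑-swap I I up) ⟩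
    ∑∑ up + ∑∑ (λ i j → up j i) + ∑∑ (nonadj G)
      ≡⟨ cong (_+ ∑∑ (nonadj G)) (∑∑-distrib-+ up (λ i j → up j i)) ⟨
    ∑∑ (λ i j → up i j + up j i) + ∑∑ (nonadj G)
      ≡⟨ ∑∑-distrib-+ (λ i j → up i j + up j i) (nonadj G) ⟨
    ∑∑ (λ i j → up i j + up j i + nonadj G i j)
      ≡⟨ ∑-cong I (λ i → ∑-cong I (trichotomy i)) ⟩
    ∑∑ (λ _ _ → 1)
      ≡⟨ ∑-cong I (λ _ → trans (∑-const I 1) (*-identityʳ (length I))) ⟩
    ∑ I (λ _ → length I)
      ≡⟨ ∑-const I (length I) ⟩
    length I * length I
      ≡⟨ cong (λ k → k * k) (length-tabulate {n = n} (λ i → i)) ⟩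
    n * n ∎
    where
    I : List (Fin n)
    I = allFin n
    ∑∑ : (Fin n → Fin n → ℕ) → ℕ
    ∑∑ f = ∑ I (λ i → ∑ I (f i))
    up : Fin n → Fin n → ℕ
    up i j = indicator ((i Fin.<? j) ×-dec adj? i j)
    edgeCount≡∑∑ : edgeCount G ≡ ∑∑ up
    edgeCount≡∑∑ = trans (length-filter-∑ (λ (i , j) → (i Fin.<? j) ×-dec adj? i j) (cartesianProduct I I))
                         (∑-cartesianProduct I I _)
    ∑∑-distrib-+ : ∀ f g → ∑∑ (λ i j → f i j + g i j) ≡ ∑∑ f + ∑∑ g
    ∑∑-distrib-+ f g = trans (∑-cong I (λ i → ∑-distrib-+ I (f i) (g i)))
                             (∑-distrib-+ I (λ i → ∑ I (f i)) (λ i → ∑ I (g i)))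
    compare : ∀ {i j} (i<j? : Dec (i Fin.< j)) (j<i? : Dec (j Fin.< i)) (ij? : Dec (Adj i j)) (ji? : Dec (Adj j i)) →
      indicator (i<j? ×-dec ij?) + indicator (j<i? ×-dec ji?) + indicator (¬? ij?) ≡ 1
    compare _         _         (yes ij) (no ¬ji) = contradiction (symm ij) ¬ji
    compare _         _         (no ¬ij) (yes ji) = contradiction (symm ji) ¬ij
    compare (yes _)   (yes _)   (no _)   (no _)   = refl
    compare (yes _)   (no _)    (no _)   (no _)   = refl
    compare (no _)    (yes _)   (no _)   (no _)   = refl
    compare (no _)    (no _)    (no _)   (no _)   = refl
    compare (yes i<j) (yes j<i) (yes _)  (yes _)  = contradiction j<i (<-asym i<j)
    compare (yes _)   (no _)    (yes _)  (yes _)  = refl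
    compare (no _)    (yes _)   (yes _)  (yes _)  = refl
    -- Here `i` and `j` coincide, so the adjacency would be a loop.
    compare (no i≮j)  (no j≮i)  (yes ij) (yes _)  =
      contradiction ij (irrefl (Fin.toℕ-injective (≤-antisym (≮⇒≥ j≮i) (≮⇒≥ i≮j))))
    trichotomy : ∀ i j → up i j + up j i + nonadj G i j ≡ 1
    trichotomy i j = compare (i Fin.<? j) (j Fin.<? i) (adj? i j) (adj? j i)

  edge-bound : ∀ {σ ρ} .{{_ : NonZero σ}} .{{_ : NonZero ρ}} (S : Subset n) →
    let α = ∣ S ∣ˢ ; β = n ∸ α in
    KFree (suc (σ + ρ)) G → KFree (suc σ) (G [ S ]) → σ * β ≤ ρ * α →
    ρ * (α * α) + σ * (β * β) + 2 * (edgeCount G) * (σ * ρ) ≤ σ * ρ * (n * n)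
  edge-bound {σ} {ρ} S G-free S-free σβ≤ρα
    -- These are the costs `α/σ` on `S` and `β/ρ` off `S`, over the common denominator `σ * ρ`.
    with clique-bound G (λ i → if does (i ∈ˢ? S) then ρ * ∣ S ∣ˢ else σ * (n ∸ ∣ S ∣ˢ)) (σ * ρ) (allFin n)
  ... | Q , Q-clique , _ , bound = begin
    ρ * (α * α) + σ * (β * β) + 2 * e * (σ * ρ)
      ≤⟨ +-monoˡ-≤ _ (*-cancelˡ-≤ D {{m*n≢0 σ ρ}} cancelled) ⟩
    D * nonedges G (allFin n) + 2 * e * D
      ≡⟨ regroup D (nonedges G (allFin n)) (2 * e) ⟩
    D * (2 * e + nonedges G (allFin n))
      ≡⟨ cong (D *_) 2*edgeCount+nonedges ⟩
    D * (n * n) ∎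
    where
    α β e D p q x y : ℕ
    α = ∣ S ∣ˢ
    β = n ∸ α
    e = edgeCount G
    D = σ * ρ
    p = ρ * α
    q = σ * β
    x = length (filter (_∈ˢ? S) Q)
    y = length (filter (¬? ∘ (_∈ˢ? S)) Q)
    c : Fin n → ℕ
    c i = if does (i ∈ˢ? S) then p else q

    regroup : ∀ D P e → D * P + e * D ≡ D * (e + P)
    regroup = solve-∀

    x≤σ : x ≤ σ
    x≤σ = KFree-[]⇒clique≤ S-free (AllPairs.filter⁺ (_∈ˢ? S) Q-clique) (all-filter (_∈ˢ? S) Q)

    x+y≤σ+ρ : x + y ≤ σ + ρ
    x+y≤σ+ρ = ≤-trans (≤-reflexive (length-filter-∁ (_∈ˢ? S) Q)) (KFree⇒clique≤ G G-free Q-clique)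

    ∑c : ∑ (allFin n) c ≡ α * p + β * q
    ∑c = trans (∑-if (_∈ˢ? S) (allFin n) p q) (cong₂ (λ a b → a * p + b * q) (filter-∈-length S) outside-length)
      where
      outside-length : length (filter (¬? ∘ (_∈ˢ? S)) (allFin n)) ≡ β
      outside-length = trans (sym (m+n∸m≡n (length (filter (_∈ˢ? S) (allFin n))) _))
        (cong₂ _∸_ (trans (length-filter-∁ (_∈ˢ? S) (allFin n)) (length-tabulate {n = n} (λ i → i)))
                   (filter-∈-length S))

    ∑c² : ∑ Q (λ v → c v * c v) ≡ x * (p * p) + y * (q * q)
    ∑c² = trans (∑-cong Q c²) (∑-if (_∈ˢ? S) Q (p * p) (q * q))
      where
      c² : ∀ v → c v * c v ≡ (if does (v ∈ˢ? S) then p * p else q * q)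
      c² v with does (v ∈ˢ? S)
      ... | true  = refl
      ... | false = refl

    cancelled : D * (ρ * (α * α) + σ * (β * β)) ≤ D * (D * nonedges G (allFin n))
    -- The bound `σp² + ρq²` for the sum of squared costs equals `D(ρα² + σβ²)`, exactly half of
    -- `2D` times the total cost, so one copy survives the cancellation.
    cancelled = +-cancelʳ-≤ (σ * (p * p) + ρ * (q * q)) _ _ (begin
      D * (ρ * (α * α) + σ * (β * β)) + (σ * (p * p) + ρ * (q * q))
        ≡⟨ twice σ ρ α β ⟩
      2 * D * (α * p + β * q)
        ≡⟨ cong (2 * D *_) ∑c ⟨
      2 * D * ∑ (allFin n) c
        ≤⟨ bound ⟩
      D * D * nonedges G (allFin n) + ∑ Q (λ v → c v * c v)
        ≤⟨ +-mono-≤ (≤-reflexive (*-assoc D D (nonedges G (allFin n))))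
             (≤-trans (≤-reflexive ∑c²) (shift-weight x≤σ x+y≤σ+ρ (*-mono-≤ σβ≤ρα σβ≤ρα))) ⟩
      D * (D * nonedges G (allFin n)) + (σ * (p * p) + ρ * (q * q)) ∎)
      where
      twice : ∀ σ ρ α β → σ * ρ * (ρ * (α * α) + σ * (β * β)) + (σ * (ρ * α * (ρ * α)) + ρ * (σ * β * (σ * β)))
        ≡ 2 * (σ * ρ) * (α * (ρ * α) + β * (σ * β))
      twice = solve-∀

-- Transfer of arithmetic from ℕ to ℚ.

fromℚᵘ-homo-+ : ∀ p q → fromℚᵘ (p ℚᵘ.+ q) ≡ fromℚᵘ p ℚ.+ fromℚᵘ q
fromℚᵘ-homo-+ p q = ℚ.toℚᵘ-injective (begin
  toℚᵘ (fromℚᵘ (p ℚᵘ.+ q))               ≈⟨ ℚ.toℚᵘ-fromℚᵘ (p ℚᵘ.+ q) ⟩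
  p ℚᵘ.+ q                               ≈⟨ ℚᵘ.+-cong (ℚ.toℚᵘ-fromℚᵘ p) (ℚ.toℚᵘ-fromℚᵘ q) ⟨
  toℚᵘ (fromℚᵘ p) ℚᵘ.+ toℚᵘ (fromℚᵘ q)   ≈⟨ ℚ.toℚᵘ-homo-+ (fromℚᵘ p) (fromℚᵘ q) ⟨
  toℚᵘ (fromℚᵘ p ℚ.+ fromℚᵘ q)           ∎)
  where open SetoidReasoning ℚᵘ.≃-setoid

fromℚᵘ-homo-* : ∀ p q → fromℚᵘ (p ℚᵘ.* q) ≡ fromℚᵘ p ℚ.* fromℚᵘ q
fromℚᵘ-homo-* p q = ℚ.toℚᵘ-injective (begin
  toℚᵘ (fromℚᵘ (p ℚᵘ.* q))               ≈⟨ ℚ.toℚᵘ-fromℚᵘ (p ℚᵘ.* q) ⟩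
  p ℚᵘ.* q                               ≈⟨ ℚᵘ.*-cong (ℚ.toℚᵘ-fromℚᵘ p) (ℚ.toℚᵘ-fromℚᵘ q) ⟨
  toℚᵘ (fromℚᵘ p) ℚᵘ.* toℚᵘ (fromℚᵘ q)   ≈⟨ ℚ.toℚᵘ-homo-* (fromℚᵘ p) (fromℚᵘ q) ⟨
  toℚᵘ (fromℚᵘ p ℚ.* fromℚᵘ q)           ∎)
  where open SetoidReasoning ℚᵘ.≃-setoid

-- In unnormalised fractions with denominator 1 this is an integer identity, free of gcds.
fromℕ-homo-+ : ∀ a b → fromℕ (a + b) ≡ fromℕ a ℚ.+ fromℕ b
fromℕ-homo-+ a b = trans
  (ℚ.fromℚᵘ-cong {mkℚᵘ (ℤ.+ (a + b)) 0} {mkℚᵘ (ℤ.+ a) 0 ℚᵘ.+ mkℚᵘ (ℤ.+ b) 0} (*≡* (identity (ℤ.+ a) (ℤ.+ b))))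
  (fromℚᵘ-homo-+ (mkℚᵘ (ℤ.+ a) 0) (mkℚᵘ (ℤ.+ b) 0))
  where
  identity : ∀ x y → (x ℤ.+ y) ℤ.* ℤ.1ℤ ≡ (x ℤ.* ℤ.1ℤ ℤ.+ y ℤ.* ℤ.1ℤ) ℤ.* ℤ.1ℤ
  identity = ℤ.solve-∀

fromℕ-homo-* : ∀ a b → fromℕ (a * b) ≡ fromℕ a ℚ.* fromℕ b
fromℕ-homo-* a b = trans
  (ℚ.fromℚᵘ-cong {mkℚᵘ (ℤ.+ (a * b)) 0} {mkℚᵘ (ℤ.+ a) 0 ℚᵘ.* mkℚᵘ (ℤ.+ b) 0} (*≡* (cong (ℤ._* ℤ.1ℤ) (ℤ.pos-* a b))))
  (fromℚᵘ-homo-* (mkℚᵘ (ℤ.+ a) 0) (mkℚᵘ (ℤ.+ b) 0))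

fromℕ-2* : ∀ a → fromℕ (2 * a) ≡ fromℕ a ℚ.+ fromℕ a
fromℕ-2* a = trans (cong (λ x → fromℕ (a + x)) (+-identityʳ a)) (fromℕ-homo-+ a a)

fromℕ-mono-≤ : ∀ {a b} → a ≤ b → fromℕ a ℚ.≤ fromℕ b
fromℕ-mono-≤ {a} {b} a≤b = ℚ.toℚᵘ-cancel-≤ (begin
  toℚᵘ (fromℕ a)  ≃⟨ ℚ.toℚᵘ-fromℚᵘ (mkℚᵘ (ℤ.+ a) 0) ⟩
  mkℚᵘ (ℤ.+ a) 0    ≤⟨ *≤* (ℤ.*-monoʳ-≤-nonNeg ℤ.1ℤ (ℤ.+≤+ a≤b)) ⟩
  mkℚᵘ (ℤ.+ b) 0    ≃⟨ ℚ.toℚᵘ-fromℚᵘ (mkℚᵘ (ℤ.+ b) 0) ⟨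
  toℚᵘ (fromℕ b)  ∎)
  where open ℚᵘ.≤-Reasoning

fromℕ-cancel-< : ∀ {a b} → fromℕ a ℚ.< fromℕ b → a < b
fromℕ-cancel-< a<b = ≰⇒> λ b≤a → ℚ.<-irrefl refl (ℚ.<-≤-trans a<b (fromℕ-mono-≤ b≤a))

fromℕ-pos : ∀ k .{{_ : NonZero k}} → Positive (fromℕ k)
fromℕ-pos k = ℚ.normalize-pos k 1

-- This equation is how a fraction enters the later arithmetic.
/-*-cancel : ∀ a b .{{_ : NonZero b}} → (ℤ.+ a / b) ℚ.* fromℕ b ≡ fromℕ a
/-*-cancel a (suc b) = trans
  (sym (fromℚᵘ-homo-* (mkℚᵘ (ℤ.+ a) b) (mkℚᵘ (ℤ.+ suc b) 0)))
  (ℚ.fromℚᵘ-cong {mkℚᵘ (ℤ.+ a) b ℚᵘ.* mkℚᵘ (ℤ.+ suc b) 0} {mkℚᵘ (ℤ.+ a) 0}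
    (*≡* (trans (identity (ℤ.+ a) (ℤ.+ suc b)) (cong (λ d → ℤ.+ a ℤ.* ℤ.+ d) (sym (*-identityʳ (suc b)))))))
  where
  identity : ∀ x y → x ℤ.* y ℤ.* ℤ.1ℤ ≡ x ℤ.* y
  identity = ℤ.solve-∀

-- Lower cuts of scaled reals and of square roots.

inv : (c : ℚ) .{{_ : Positive c}} → ℚ
inv c = (1/ c) {{ℚ.pos⇒nonZero c}}

inv-inverseˡ : ∀ c .{{_ : Positive c}} → inv c ℚ.* c ≡ 1ℚ
inv-inverseˡ c = ℚ.*-inverseˡ c {{ℚ.pos⇒nonZero c}}

-- Scaling branches on the sign of `c`; positivity leaves only the `scale⁺` branch, where the cuts
-- agree by definition.
L-ℚ* : ∀ c .{{_ : Positive c}} x q → ℝ.L (c ℚ* x) q ≡ ℝ.L x (inv c ℚ.* q)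
L-ℚ* c x q with ℚ.<-cmp 0ℚ c
... | tri< _ _ _   = refl
... | tri≈ _ 0≡c _ = contradiction (ℚ.positive⁻¹ c) (ℚ.<-irrefl 0≡c)
... | tri> 0≮c _ _ = contradiction (ℚ.positive⁻¹ c) 0≮c

-- A negative `p` lies below every root. Otherwise the cut asks for a larger number whose square is
-- below `x`, and density supplies one between `p` and `y`.
L-√ : ∀ x {p y} → p ℚ.< y → (∀ {m} → 0ℚ ℚ.≤ m → m ℚ.< y → ℝ.L x (m ℚ.* m)) → ℝ.L (√ x) p
L-√ x {p} p<y below with p ℚ.<? 0ℚ
... | yes p<0 = inj₁ p<0
... | no  p≮0 with m , p<m , m<y ← ℚ.<-dense p<y =
  let 0≤m = ℚ.≤-trans (ℚ.≮⇒≥ p≮0) (ℚ.<⇒≤ p<m) in inj₂ (m , 0≤m , p<m , below 0≤m m<y)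

open +-*-Solver using (solve; _:+_; _:*_; _:-_; :-_; _:=_; con)
square-mono-< : ∀ {p q} → 0ℚ ℚ.≤ p → p ℚ.< q → p ℚ.* p ℚ.< q ℚ.* q
square-mono-< {p} {q} 0≤p p<q = begin-strict
  p ℚ.* p  ≤⟨ ℚ.*-monoˡ-≤-nonNeg p {{nonNegative 0≤p}} (ℚ.<⇒≤ p<q) ⟩
  p ℚ.* q  <⟨ ℚ.*-monoˡ-<-pos q {{positive (ℚ.≤-<-trans 0≤p p<q)}} p<q ⟩
  q ℚ.* q  ∎
  where open ℚ.≤-Reasoning

-- The edge bound in terms of densities.

module _ (n τ σ α a i m : ℚ) .{{_ : Positive n}} .{{_ : Positive τ}}
         (a≡σ/τ : a ℚ.* τ ≡ σ) (i≡1/n : i ℚ.* n ≡ 1ℚ) (m<excess : m ℚ.< i ℚ.* α ℚ.- a) where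

  open ℚ.≤-Reasoning

  clear-excess : m ℚ.* n ℚ.* τ ℚ.< τ ℚ.* α ℚ.- σ ℚ.* n
  clear-excess = begin-strict
    m ℚ.* n ℚ.* τ
      <⟨ ℚ.*-monoˡ-<-pos τ (ℚ.*-monoˡ-<-pos n m<excess) ⟩
    (i ℚ.* α ℚ.- a) ℚ.* n ℚ.* τ
      ≡⟨ solve 5 (λ i α a n τ → (i :* α :- a) :* n :* τ := (i :* n) :* (τ :* α) :- (a :* τ) :* n) refl i α a n τ ⟩
    (i ℚ.* n) ℚ.* (τ ℚ.* α) ℚ.- (a ℚ.* τ) ℚ.* n
      ≡⟨ cong₂ (λ x y → x ℚ.* (τ ℚ.* α) ℚ.- y ℚ.* n) i≡1/n a≡σ/τ ⟩
    1ℚ ℚ.* (τ ℚ.* α) ℚ.- σ ℚ.* n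
      ≡⟨ cong (ℚ._- σ ℚ.* n) (ℚ.*-identityˡ (τ ℚ.* α)) ⟩
    τ ℚ.* α ℚ.- σ ℚ.* n ∎

module _ (σ ρ α β e h j i m : ℚ) .{{_ : Positive σ}} .{{_ : Positive ρ}} where

  open ℚ.≤-Reasoning

  private
    n τ W w y X : ℚ
    n = α ℚ.+ β
    τ = σ ℚ.+ ρ
    W = (n ℚ.* n) ℚ.* (σ ℚ.* ρ ℚ.+ σ ℚ.* ρ) ℚ.* τ
    w = m ℚ.* n ℚ.* τ
    y = τ ℚ.* α ℚ.- σ ℚ.* n
    X = e ℚ.* (σ ℚ.* ρ ℚ.+ σ ℚ.* ρ) ℚ.* τ

  -- Here `j = τ/(2σρ)`, `h = (τ-1)/(2τ)` and `i = 1/n²`, so the conclusion reads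
  -- `e/n² < h - m²τ/(2σρ)`. Both sides are compared after multiplication by the common denominator
  -- `W`.
  density-bound : .{{_ : Positive (α ℚ.+ β)}} →
    j ℚ.* (σ ℚ.* ρ ℚ.+ σ ℚ.* ρ) ≡ σ ℚ.+ ρ →
    h ℚ.* (τ ℚ.+ τ) ≡ τ ℚ.- 1ℚ →
    i ℚ.* (n ℚ.* n) ≡ 1ℚ →
    ρ ℚ.* (α ℚ.* α) ℚ.+ σ ℚ.* (β ℚ.* β) ℚ.+ (e ℚ.+ e) ℚ.* (σ ℚ.* ρ) ℚ.≤ σ ℚ.* ρ ℚ.* (n ℚ.* n) →
    0ℚ ℚ.≤ m → w ℚ.< y →
    i ℚ.* e ℚ.< ℚ.- (j ℚ.* (m ℚ.* m) ℚ.- h)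
  density-bound j-eq h-eq i-eq edges 0≤m w<y = ℚ.*-cancelʳ-<-nonNeg W {{ℚ.pos⇒nonNeg W {{W-pos}}}} (begin-strict
    (i ℚ.* e) ℚ.* W
      ≡⟨ solve 5 (λ i e N D τ → i :* e :* (N :* D :* τ) := i :* N :* (e :* D :* τ))
           refl i e (n ℚ.* n) (σ ℚ.* ρ ℚ.+ σ ℚ.* ρ) τ ⟩
    i ℚ.* (n ℚ.* n) ℚ.* X
      ≡⟨ trans (cong (ℚ._* X) i-eq) (ℚ.*-identityˡ X) ⟩
    X
      ≡⟨ solve 2 (λ X Y → X := X :+ Y :- Y) refl X (w ℚ.* w) ⟩
    X ℚ.+ w ℚ.* w ℚ.- w ℚ.* w
      <⟨ ℚ.+-monoˡ-< (ℚ.- (w ℚ.* w)) (ℚ.+-monoʳ-< X (square-mono-< 0≤w w<y)) ⟩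
    X ℚ.+ y ℚ.* y ℚ.- w ℚ.* w
      -- Completing the square: `y = ρα - σβ`, hence `y² = τ(ρα² + σβ²) - σρn²`.
      ≡⟨ cong (ℚ._- w ℚ.* w) (solve 5 (λ σ ρ α β e →
           e :* (σ :* ρ :+ σ :* ρ) :* (σ :+ ρ) :+ ((σ :+ ρ) :* α :- σ :* (α :+ β)) :* ((σ :+ ρ) :* α :- σ :* (α :+ β))
           := (σ :+ ρ) :* (ρ :* (α :* α) :+ σ :* (β :* β) :+ (e :+ e) :* (σ :* ρ)) :- σ :* ρ :* ((α :+ β) :* (α :+ β)))
           refl σ ρ α β e) ⟩
    τ ℚ.* (ρ ℚ.* (α ℚ.* α) ℚ.+ σ ℚ.* (β ℚ.* β) ℚ.+ (e ℚ.+ e) ℚ.* (σ ℚ.* ρ)) ℚ.- σ ℚ.* ρ ℚ.* (n ℚ.* n) ℚ.- w ℚ.* w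
      ≤⟨ ℚ.+-monoˡ-≤ (ℚ.- (w ℚ.* w)) (ℚ.+-monoˡ-≤ (ℚ.- (σ ℚ.* ρ ℚ.* (n ℚ.* n)))
           (ℚ.*-monoˡ-≤-nonNeg τ {{ℚ.pos⇒nonNeg τ {{τ-pos}}}} edges)) ⟩
    τ ℚ.* (σ ℚ.* ρ ℚ.* (n ℚ.* n)) ℚ.- σ ℚ.* ρ ℚ.* (n ℚ.* n) ℚ.- w ℚ.* w
      ≡⟨ solve 4 (λ τ D n m → τ :* (D :* (n :* n)) :- D :* (n :* n) :- (m :* n :* τ) :* (m :* n :* τ)
           := (τ :- con 1ℚ) :* (n :* n :* D) :- τ :* (m :* m :* (n :* n) :* τ)) refl τ (σ ℚ.* ρ) n m ⟩
    (τ ℚ.- 1ℚ) ℚ.* (n ℚ.* n ℚ.* (σ ℚ.* ρ)) ℚ.- τ ℚ.* (m ℚ.* m ℚ.* (n ℚ.* n) ℚ.* τ)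
      ≡⟨ cong₂ (λ u v → u ℚ.* (n ℚ.* n ℚ.* (σ ℚ.* ρ)) ℚ.- v ℚ.* (m ℚ.* m ℚ.* (n ℚ.* n) ℚ.* τ)) h-eq j-eq ⟨
    h ℚ.* (τ ℚ.+ τ) ℚ.* (n ℚ.* n ℚ.* (σ ℚ.* ρ)) ℚ.- j ℚ.* (σ ℚ.* ρ ℚ.+ σ ℚ.* ρ) ℚ.* (m ℚ.* m ℚ.* (n ℚ.* n) ℚ.* τ)
      ≡⟨ solve 6 (λ h j τ D N M → h :* (τ :+ τ) :* (N :* D) :- j :* (D :+ D) :* (M :* N :* τ)
           := :- (j :* M :- h) :* (N :* (D :+ D) :* τ)) refl h j τ (σ ℚ.* ρ) (n ℚ.* n) (m ℚ.* m) ⟩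
    ℚ.- (j ℚ.* (m ℚ.* m) ℚ.- h) ℚ.* W ∎)
    where
    σρ-pos : Positive (σ ℚ.* ρ)
    σρ-pos = ℚ.pos*pos⇒pos σ ρ
    τ-pos : Positive τ
    τ-pos = ℚ.pos+pos⇒pos σ ρ
    W-pos : Positive W
    W-pos = ℚ.pos*pos⇒pos (n ℚ.* n ℚ.* (σ ℚ.* ρ ℚ.+ σ ℚ.* ρ))
      {{ℚ.pos*pos⇒pos (n ℚ.* n) {{ℚ.pos*pos⇒pos n n}} (σ ℚ.* ρ ℚ.+ σ ℚ.* ρ)
        {{ℚ.pos+pos⇒pos (σ ℚ.* ρ) {{σρ-pos}} (σ ℚ.* ρ) {{σρ-pos}}}}}}
      τ {{τ-pos}}
    0≤w : 0ℚ ℚ.≤ w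
    0≤w = ℚ.nonNegative⁻¹ w {{ℚ.nonNeg*nonNeg⇒nonNeg (m ℚ.* n)
      {{ℚ.nonNeg*nonNeg⇒nonNeg m {{nonNegative 0≤m}} n {{ℚ.pos⇒nonNeg n}}}} τ {{ℚ.pos⇒nonNeg τ {{τ-pos}}}}}}

-- The bound for a single `Kₛ`-free set.

-- The fractions enter as variables a, h, k: for the literal ones, unfolding the cuts makes Agda
-- normalise gcd computations.
module _ (r s : ℕ) (3≤r : 3 ≤ r) (2≤s : 2 ≤ s) (s≤r : s ≤ r)
         (a h k : ℚ)
         (a*τ : a ℚ.* fromℕ (r ∸ 1) ≡ fromℕ (s ∸ 1))
         (h*2τ : h ℚ.* fromℕ (2 * (r ∸ 1)) ≡ fromℕ (r ∸ 2))
         (k*τ : k ℚ.* fromℕ (r ∸ 1) ≡ fromℕ (2 * (s ∸ 1) * (r ∸ s)))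
         (γ : ℝ) (n : ℕ) .{{_ : NonZero n}}
         (G : Graph (Fin n)) (G-free : KFree r G)
         (γ-edges : fromℕ (n * n) ℚ* γ ≤ℝ fromℚ (fromℕ (edgeCount G)))
         (S : Subset n) (S-free : KFree s (G [ S ])) where

  private
    σ ρ τ α β e : ℕ
    σ = s ∸ 1
    ρ = r ∸ s
    τ = r ∸ 1
    α = ∣ S ∣ˢ
    β = n ∸ α
    e = edgeCount G

    instance
      n-pos : Positive (fromℕ n)
      n-pos = fromℕ-pos n
      n²-pos : Positive (fromℕ (n * n))
      n²-pos = fromℕ-pos (n * n) {{m*n≢0 n n}}
      τ≢0 : NonZero τ
      τ≢0 = r∸1-nonZero 3≤r
      σ≢0 : NonZero σ
      σ≢0 = >-nonZero (∸-monoˡ-≤ 1 2≤s)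

    1≤s : 1 ≤ s
    1≤s = ≤-trans (s≤s z≤n) 2≤s

    suc-σ : suc σ ≡ s
    suc-σ = m+[n∸m]≡n 1≤s

    τ≡σ+ρ : τ ≡ σ + ρ
    τ≡σ+ρ = cong (_∸ 1) (trans (sym (m+[n∸m]≡n s≤r)) (cong (_+ ρ) (sym suc-σ)))

    suc-σ+ρ : suc (σ + ρ) ≡ r
    suc-σ+ρ = trans (cong (_+ ρ) suc-σ) (m+[n∸m]≡n s≤r)

    n≡α+β : n ≡ α + β
    n≡α+β = sym (m+[n∸m]≡n (∣p∣≤n S))

  -- For positive `k`, `m² < k(h - γ)` unfolds to `γ < h - m²/k`, a statement about the upper cut of
  -- `γ`. It follows from `γ ≤ e/n²` and `density-bound`.
  excess-below-√ : ∀ {m} → 0ℚ ℚ.≤ m → m ℚ.< inv (fromℕ n) ℚ.* fromℕ α ℚ.- a →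
    ℝ.L (k ℚ* (h ℚ+ (-ℝ γ))) (m ℚ.* m)
  excess-below-√ {m} 0≤m m<excess = subst (λ A → A) (sym (L-ℚ* k {{k-pos}} (h ℚ+ (-ℝ γ)) (m ℚ.* m))) Uγ
    where
    A B Σ P E N T : ℚ
    A = fromℕ α
    B = fromℕ β
    Σ = fromℕ σ
    P = fromℕ ρ
    E = fromℕ e
    N = fromℕ n
    T = fromℕ τ

    N≡A+B : N ≡ A ℚ.+ B
    N≡A+B = trans (cong fromℕ n≡α+β) (fromℕ-homo-+ α β)

    T≡Σ+P : T ≡ Σ ℚ.+ P
    T≡Σ+P = trans (cong fromℕ τ≡σ+ρ) (fromℕ-homo-+ σ ρ)

    cleared : m ℚ.* N ℚ.* T ℚ.< T ℚ.* A ℚ.- Σ ℚ.* N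
    cleared = clear-excess N T Σ A a (inv N) m {{n-pos}} {{fromℕ-pos τ}}
      a*τ (inv-inverseˡ N) m<excess

    ΣN<TA : Σ ℚ.* N ℚ.< T ℚ.* A
    ΣN<TA = begin-strict
      Σ ℚ.* N
        ≡⟨ ℚ.+-identityˡ (Σ ℚ.* N) ⟨
      0ℚ ℚ.+ Σ ℚ.* N
        ≤⟨ ℚ.+-monoˡ-≤ (Σ ℚ.* N) 0≤w ⟩
      m ℚ.* N ℚ.* T ℚ.+ Σ ℚ.* N
        <⟨ ℚ.+-monoˡ-< (Σ ℚ.* N) cleared ⟩
      T ℚ.* A ℚ.- Σ ℚ.* N ℚ.+ Σ ℚ.* N
        ≡⟨ solve 2 (λ x y → x :- y :+ y := x) refl (T ℚ.* A) (Σ ℚ.* N) ⟩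
      T ℚ.* A ∎
      where
      open ℚ.≤-Reasoning
      0≤w : 0ℚ ℚ.≤ m ℚ.* N ℚ.* T
      0≤w = ℚ.nonNegative⁻¹ (m ℚ.* N ℚ.* T) {{ℚ.nonNeg*nonNeg⇒nonNeg (m ℚ.* N)
        {{ℚ.nonNeg*nonNeg⇒nonNeg m {{nonNegative 0≤m}} N {{ℚ.pos⇒nonNeg N}}}} T
        {{ℚ.pos⇒nonNeg T {{fromℕ-pos τ}}}}}}

    -- After adding `σα` to both sides this is `σn < τα`: a nonnegative `m` below the excess makes
    -- the excess positive.
    σβ<ρα : σ * β < ρ * α
    σβ<ρα = +-cancelˡ-< (σ * α) _ _ (subst₂ _<_
      (trans (cong (σ *_) n≡α+β) (*-distribˡ-+ σ α β))
      (trans (cong (_* α) τ≡σ+ρ) (*-distribʳ-+ α σ ρ))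
      (fromℕ-cancel-< (subst₂ ℚ._<_ (sym (fromℕ-homo-* σ n)) (sym (fromℕ-homo-* τ α)) ΣN<TA)))

    -- This rules out `s = r`: there the excess `α/n - 1` is never positive.
    ρ≢0 : NonZero ρ
    ρ≢0 = m*n≢0⇒m≢0 ρ {{>-nonZero (≤-<-trans z≤n σβ<ρα)}}

    k-pos : Positive k
    k-pos = positive (ℚ.*-cancelʳ-<-nonNeg T {{ℚ.pos⇒nonNeg T {{fromℕ-pos τ}}}} {0ℚ} {k}
      (subst₂ ℚ._<_ (sym (ℚ.*-zeroˡ T)) (sym k*τ) (ℚ.positive⁻¹ (fromℕ (2 * σ * ρ)) {{2σρ-pos}})))
      where
      2σρ-pos : Positive (fromℕ (2 * σ * ρ))
      2σρ-pos = fromℕ-pos (2 * σ * ρ) {{m*n≢0 (2 * σ) ρ {{m*n≢0 2 σ}} {{ρ≢0}}}}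

    fromℕ-2σρ : fromℕ (2 * σ * ρ) ≡ Σ ℚ.* P ℚ.+ Σ ℚ.* P
    fromℕ-2σρ = trans (cong fromℕ (*-assoc 2 σ ρ))
      (trans (fromℕ-2* (σ * ρ)) (cong (λ x → x ℚ.+ x) (fromℕ-homo-* σ ρ)))

    1/k-eq : inv k {{k-pos}} ℚ.* (Σ ℚ.* P ℚ.+ Σ ℚ.* P) ≡ Σ ℚ.+ P
    1/k-eq = begin
      inv k ℚ.* (Σ ℚ.* P ℚ.+ Σ ℚ.* P)  ≡⟨ cong (inv k ℚ.*_) fromℕ-2σρ ⟨
      inv k ℚ.* fromℕ (2 * σ * ρ)      ≡⟨ cong (inv k ℚ.*_) k*τ ⟨
      inv k ℚ.* (k ℚ.* T)              ≡⟨ ℚ.*-assoc (inv k) k T ⟨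
      inv k ℚ.* k ℚ.* T                ≡⟨ cong (ℚ._* T) (inv-inverseˡ k) ⟩
      1ℚ ℚ.* T                         ≡⟨ ℚ.*-identityˡ T ⟩
      T                                ≡⟨ T≡Σ+P ⟩
      Σ ℚ.+ P                          ∎
      where
      open ≡-Reasoning
      instance
        _ : Positive k
        _ = k-pos

    h-eq : h ℚ.* ((Σ ℚ.+ P) ℚ.+ (Σ ℚ.+ P)) ≡ (Σ ℚ.+ P) ℚ.- 1ℚ
    h-eq = begin
      h ℚ.* ((Σ ℚ.+ P) ℚ.+ (Σ ℚ.+ P))  ≡⟨ cong (λ x → h ℚ.* (x ℚ.+ x)) T≡Σ+P ⟨
      h ℚ.* (T ℚ.+ T)                  ≡⟨ cong (h ℚ.*_) (fromℕ-2* τ) ⟨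
      h ℚ.* fromℕ (2 * τ)              ≡⟨ h*2τ ⟩
      fromℕ (r ∸ 2)                    ≡⟨ solve 2 (λ x y → x := y :+ x :- y) refl (fromℕ (r ∸ 2)) 1ℚ ⟩
      1ℚ ℚ.+ fromℕ (r ∸ 2) ℚ.- 1ℚ      ≡⟨ cong (ℚ._- 1ℚ) (fromℕ-homo-+ 1 (r ∸ 2)) ⟨
      fromℕ (1 + (r ∸ 2)) ℚ.- 1ℚ       ≡⟨ cong (λ x → fromℕ x ℚ.- 1ℚ) (+-∸-assoc 1 (≤-trans (n≤1+n 2) 3≤r)) ⟨
      T ℚ.- 1ℚ                         ≡⟨ cong (ℚ._- 1ℚ) T≡Σ+P ⟩
      (Σ ℚ.+ P) ℚ.- 1ℚ                 ∎
      where open ≡-Reasoning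

    n²-eq : fromℕ (n * n) ≡ (A ℚ.+ B) ℚ.* (A ℚ.+ B)
    n²-eq = trans (fromℕ-homo-* n n) (cong (λ x → x ℚ.* x) N≡A+B)

    edges : P ℚ.* (A ℚ.* A) ℚ.+ Σ ℚ.* (B ℚ.* B) ℚ.+ (E ℚ.+ E) ℚ.* (Σ ℚ.* P)
            ℚ.≤ Σ ℚ.* P ℚ.* ((A ℚ.+ B) ℚ.* (A ℚ.+ B))
    edges = subst₂ ℚ._≤_ lhs rhs (fromℕ-mono-≤ (edge-bound G {{σ≢0}} {{ρ≢0}} S
      (subst (λ x → KFree x G) (sym suc-σ+ρ) G-free)
      (subst (λ x → KFree x (G [ S ])) (sym suc-σ) S-free)
      (<⇒≤ σβ<ρα)))
      where
      cube : ∀ x y → fromℕ (x * (y * y)) ≡ fromℕ x ℚ.* (fromℕ y ℚ.* fromℕ y)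
      cube x y = trans (fromℕ-homo-* x (y * y)) (cong (fromℕ x ℚ.*_) (fromℕ-homo-* y y))
      lhs : fromℕ (ρ * (α * α) + σ * (β * β) + 2 * e * (σ * ρ)) ≡
            P ℚ.* (A ℚ.* A) ℚ.+ Σ ℚ.* (B ℚ.* B) ℚ.+ (E ℚ.+ E) ℚ.* (Σ ℚ.* P)
      lhs = trans (fromℕ-homo-+ (ρ * (α * α) + σ * (β * β)) (2 * e * (σ * ρ))) (cong₂ ℚ._+_
        (trans (fromℕ-homo-+ (ρ * (α * α)) (σ * (β * β))) (cong₂ ℚ._+_ (cube ρ α) (cube σ β)))
        (trans (fromℕ-homo-* (2 * e) (σ * ρ)) (cong₂ ℚ._*_ (fromℕ-2* e) (fromℕ-homo-* σ ρ))))
      rhs : fromℕ (σ * ρ * (n * n)) ≡ Σ ℚ.* P ℚ.* ((A ℚ.+ B) ℚ.* (A ℚ.+ B))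
      rhs = trans (fromℕ-homo-* (σ * ρ) (n * n)) (cong₂ ℚ._*_ (fromℕ-homo-* σ ρ) n²-eq)

    gap : inv (fromℕ (n * n)) ℚ.* E ℚ.< ℚ.- (inv k {{k-pos}} ℚ.* (m ℚ.* m) ℚ.- h)
    gap = density-bound Σ P A B E h (inv k {{k-pos}}) (inv (fromℕ (n * n))) m
      {{fromℕ-pos σ}} {{fromℕ-pos ρ {{ρ≢0}}}} {{subst Positive N≡A+B n-pos}}
      1/k-eq h-eq
      (trans (cong (inv (fromℕ (n * n)) ℚ.*_) (sym n²-eq)) (inv-inverseˡ (fromℕ (n * n))))
      edges 0≤m
      (subst₂ (λ x t → m ℚ.* x ℚ.* t ℚ.< t ℚ.* A ℚ.- Σ ℚ.* x) N≡A+B T≡Σ+P cleared)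

    Uγ : ℝ.U γ (ℚ.- (inv k {{k-pos}} ℚ.* (m ℚ.* m) ℚ.- h))
    -- Locatedness of `γ` between `e/n²` and the larger bound leaves two cases; `e/n² < γ` would
    -- give `e < e` by the edge hypothesis.
    Uγ = fromInj₂
      (λ L → contradiction (γ-edges (subst (λ X → X) (sym (L-ℚ* (fromℕ (n * n)) γ E)) L)) (ℚ.<-irrefl refl))
      (ℝ.located γ gap)

  -- For `q < α`, the number `q/n - a` lies below the excess `α/n - a`, which serves as `y` in
  -- `L-√`.
  size-bound : fromℚ (fromℕ α) ≤ℝ fromℕ n ℚ* (a ℚ+ √ (k ℚ* (h ℚ+ (-ℝ γ))))
  size-bound {q} q<α = subst (λ X → X) (sym (L-ℚ* (fromℕ n) (a ℚ+ √ (k ℚ* (h ℚ+ (-ℝ γ)))) q))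
    (L-√ (k ℚ* (h ℚ+ (-ℝ γ)))
      (ℚ.+-monoˡ-< (ℚ.- a) (ℚ.*-monoʳ-<-pos (inv (fromℕ n)) {{ℚ.1/pos⇒pos (fromℕ n)}} q<α))
      excess-below-√)

-- Instantiation with the actual fractions.

radicandFactor : (r s : ℕ) → 3 ≤ r → ℚ
radicandFactor r s 3≤r = (ℤ.+ (2 * (s ∸ 1) * (r ∸ s)) / (r ∸ 1)) {{r∸1-nonZero 3≤r}}

-- An equation between reals, since comparing their cuts makes Agda normalise the fraction.
d≡√ : ∀ r s 3≤r γ → d r s 3≤r γ ≡ √ (radicandFactor r s 3≤r ℚ* (halfTuránDensity r 3≤r ℚ+ (-ℝ γ)))
d≡√ r s 3≤r γ = refl

theorem1p5 : (r s : ℕ) (3≤r : 3 ≤ r) → 2 ≤ s → s ≤ r →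
    (γ : ℝ) → fromℚ 0ℚ ≤ℝ γ → γ ≤ℝ fromℚ (halfTuránDensity r 3≤r) →
    (n : ℕ) (G : Graph (Fin n)) → KFree r G →
    fromℕ (n * n) ℚ* γ ≤ℝ fromℚ (fromℕ (edgeCount G)) →
    (α : ℕ) → IsKIndependenceNumber s G α →
    fromℚ (fromℕ α) ≤ℝ fromℕ n ℚ* (partRatio r s 3≤r ℚ+ d r s 3≤r γ)
theorem1p5 r s 3≤r 2≤s s≤r γ _ _ zero G G-free γ-edges α ((S , refl , S-free) , _) q<α
  with ∣ S ∣ˢ | ∣p∣≤n S
-- For `n = 0` the set is empty and scaling by zero yields the real 0, so both sides are 0.
... | zero | _ = q<α
theorem1p5 r s 3≤r 2≤s s≤r γ _ _ n@(suc _) G G-free γ-edges α ((S , refl , S-free) , _) =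
  subst (λ x → fromℚ (fromℕ ∣ S ∣ˢ) ≤ℝ fromℕ n ℚ* (partRatio r s 3≤r ℚ+ x)) (sym (d≡√ r s 3≤r γ))
    (size-bound r s 3≤r 2≤s s≤r
      (partRatio r s 3≤r) (halfTuránDensity r 3≤r) (radicandFactor r s 3≤r)
      (/-*-cancel (s ∸ 1) (r ∸ 1)) (/-*-cancel (r ∸ 2) (2 * (r ∸ 1)) {{m*n≢0 2 (r ∸ 1)}})
      (/-*-cancel (2 * (s ∸ 1) * (r ∸ s)) (r ∸ 1))
      γ n G G-free γ-edges S S-free)
  where
  instance
    r∸1≢0 : NonZero (r ∸ 1)
    r∸1≢0 = r∸1-nonZero 3≤r
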